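{- The calculus $\mathsf{qG}$ is decidable: there is an algorithm which, given formulas $\alpha,\beta$, decides whether $\vdash_{\mathsf{qG}}\alpha\Rightarrow\beta$.
   Context: Formulas are built from propositional variables by $\alpha\cdot\beta$, $\alpha\backslash\beta$, $\alpha\wedge\beta$, $\alpha\vee\beta$, $\neg\alpha$; sequents are $\alpha\Rightarrow\beta$ with single formulas. The calculus $\mathsf{qG}$ has axiom $(\mathrm{Id})\ \alpha\Rightarrow\alpha$ and rules (premises / conclusion): $(\mathrm{RES}\backslash)$ $\alpha\cdot\beta\Rightarrow\gamma$ / $\beta\Rightarrow\alpha\backslash\gamma$; $(\mathrm{RES}^-\backslash)$ $\beta\Rightarrow\alpha\backslash\gamma$ / $\alpha\cdot\beta\Rightarrow\gamma$; $(\wedge\mathrm{L})$ $\alpha\Rightarrow\beta$ / $\alpha\wedge\gamma\Rightarrow\beta$ and $\alpha\Rightarrow\beta$ / $\gamma\wedge\alpha\Rightarrow\beta$; $(\wedge\mathrm{R})$ $\alpha\Rightarrow\beta$, $\alpha\Rightarrow\gamma$ / $\alpha\Rightarrow\beta\wedge\gamma$; $(\vee\mathrm{L})$ $\alpha\Rightarrow\beta$, $\gamma\Rightarrow\beta$ / $\alpha\vee\gamma\Rightarrow\beta$; $(\vee\mathrm{R})$ $\alpha\Rightarrow\beta$ / $\alpha\Rightarrow\beta\vee\gamma$ and $\alpha\Rightarrow\beta$ / $\alpha\Rightarrow\gamma\vee\beta$; $(\neg)$ $\alpha\cdot\beta\Rightarrow\neg\gamma$ / $\gamma\cdot\beta\Rightarrow\neg\alpha$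 and its special case $(\mathrm{MN})$ $\alpha\Rightarrow\neg\gamma$ / $\gamma\Rightarrow\neg\alpha$; $(\mathrm{Cut})$ $\alpha\Rightarrow\beta$, $\beta\Rightarrow\gamma$ / $\alpha\Rightarrow\gamma$. -}

module Defs where

open import Data.Nat using (ℕ)

data Formula : Set where
  var  : ℕ → Formula
  _·_  : Formula → Formula → Formula
  _\\_ : Formula → Formula → Formula
  _∧_  : Formula → Formula → Formula
  _∨_  : Formula → Formula → Formula
  ¬_   : Formula → Formula

infixr 30 ¬_
infixl 25 _·_
infixr 24 _\\_
infixl 22 _∧_
infixl 21 _∨_
infix  10 _⇒_

data _⇒_ : Formula → Formula → Set where
  Id     : ∀ {α} → α ⇒ α
  RES\\  : ∀ {α β γ} → α · β ⇒ γ → β ⇒ α \\ γ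
  RES⁻\\ : ∀ {α β γ} → β ⇒ α \\ γ → α · β ⇒ γ
  ∧L₁    : ∀ {α β γ} → α ⇒ β → α ∧ γ ⇒ β
  ∧L₂    : ∀ {α β γ} → α ⇒ β → γ ∧ α ⇒ β
  ∧R     : ∀ {α β γ} → α ⇒ β → α ⇒ γ → α ⇒ β ∧ γ
  ∨L     : ∀ {α β γ} → α ⇒ β → γ ⇒ β → α ∨ γ ⇒ β
  ∨R₁    : ∀ {α β γ} → α ⇒ β → α ⇒ β ∨ γ
  ∨R₂    : ∀ {α β γ} → α ⇒ β → α ⇒ γ ∨ β
  Neg    : ∀ {α β γ} → α · β ⇒ ¬ γ → γ · β ⇒ ¬ α
  MN     : ∀ {α γ} → α ⇒ ¬ γ → γ ⇒ ¬ α
  Cut    : ∀ {α β γ} → α ⇒ β → β ⇒ γ → α ⇒ γ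

{-# OPTIONS --safe #-}
module Submission where

open import Defs
open import Relation.Nullary using (Dec)
open import Data.Empty using (⊥-elim)
open import Data.List using (List; []; _∷_; _++_; map; upTo; length; cartesianProduct; cartesianProductWith)
open import Data.List.Membership.Propositional using (_∈_; lose)
open import Data.List.Membership.Propositional.Properties using (∈-map⁺; ∈-upTo⁺; ∈-++⁺ˡ; ∈-++⁺ʳ; ∈-cartesianProductWith⁺; ∈-cartesianProduct⁺)
open import Data.List.Relation.Unary.All using (All; []; _∷_; all?; lookup)
open import Data.List.Relation.Unary.Any using (Any; here; there; any?)
open import Data.List.Relation.Unary.Any.Properties using (++⁺ˡ; ++⁺ʳ; map⁺)
open import Data.Nat using (ℕ; zero; suc; _+_; _≤_; _<_; s≤s; z≤n; _≤?_; _⊔_)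
import Data.Nat as ℕ
open import Data.Nat.Properties hiding (_≟_; _≤?_)
open import Data.Nat.Tactic.RingSolver using (solve-∀)
open import Data.Product using (_×_; _,_; proj₁; proj₂; ∃)
open import Data.Product.Properties using (≡-dec)
open import Data.Sum using (_⊎_; inj₁; inj₂)
open import Data.Unit using (⊤; tt)
open import Function using (_∘_)
open import Relation.Binary using (DecidableEquality)
open import Relation.Binary.PropositionalEquality using (_≡_; refl; sym; subst; subst₂; cong; cong₂)
open import Relation.Nullary using (yes; no; contradiction; map′; _×-dec_)

-- Every derivable sequent α ⇒ β has a derivation all of whose formulas have size
-- at most a bound B computed from α and β; saturating the finite set of sequents
-- of size ≤ B under the rules then decides derivability.  The bound comes from a
-- model of the whole calculus (Cut included) whose points are structured
-- products and whose closed sets are cut out by derivability of size ≤ B.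
--
-- The left argument of a product is delicate: · is not even congruent in it, so
-- it can be changed only below a negation.  There n · p ⇒ ¬ m is symmetric in n
-- and m, and n may be replaced by any δ with n ⇒ ¬ ¬ δ.  Read backwards this step
-- introduces a new formula δ, and the heart of the argument is that it is needed
-- only when δ can still be matched: either δ weighs less than the formula on the
-- right, or δ and everything between it and the innermost right factor weigh less
-- than that factor.  In both cases the weight of the sequent remains bounded.

-- Size and weight of formulas

size : Formula → ℕ
size (var n)  = suc n
size (α · β)  = suc (size α + size β)
size (α \\ β) = suc (size α + size β)
size (α ∧ β)  = suc (size α + size β)
size (α ∨ β)  = suc (size α + size β)
size (¬ α)    = suc (size α)

-- The doubling pays for premises in which α · β or α \\ β gives rise to ¬ α, and
-- for those in which ¬ ε is traded for ε together with a δ no heavier than ε.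
wt : Formula → ℕ
wt (var n)  = suc n
wt (α · β)  = suc (wt α + wt α) + wt β
wt (α \\ β) = suc (wt α + wt α) + wt β
wt (α ∧ β)  = suc (wt α + wt β)
wt (α ∨ β)  = suc (wt α + wt β)
wt (¬ α)    = suc (wt α + wt α)

size≤wt : ∀ α → size α ≤ wt α
size≤wt (var n)  = ≤-refl
size≤wt (α · β)  = s≤s (+-mono-≤ (≤-trans (size≤wt α) (m≤m+n _ _)) (size≤wt β))
size≤wt (α \\ β) = s≤s (+-mono-≤ (≤-trans (size≤wt α) (m≤m+n _ _)) (size≤wt β))
size≤wt (α ∧ β)  = s≤s (+-mono-≤ (size≤wt α) (size≤wt β))
size≤wt (α ∨ β)  = s≤s (+-mono-≤ (size≤wt α) (size≤wt β))
size≤wt (¬ α)    = s≤s (≤-trans (size≤wt α) (m≤m+n _ _))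

0<wt : ∀ α → 0 < wt α
0<wt (var n)  = s≤s z≤n
0<wt (α · β)  = s≤s z≤n
0<wt (α \\ β) = s≤s z≤n
0<wt (α ∧ β)  = s≤s z≤n
0<wt (α ∨ β)  = s≤s z≤n
0<wt (¬ α)    = s≤s z≤n

-- Relations closed under the rules up to a size bound

-- A size bound is demanded only of a conclusion formula that neither is a formula of a premise nor
-- a part of one.
record Closed (B : ℕ) (_⊢_ : Formula → Formula → Set) : Set where
  field
    ident  : ∀ {α} → size α ≤ B → α ⊢ α
    res    : ∀ {α β γ} → size (α \\ γ) ≤ B → α · β ⊢ γ → β ⊢ α \\ γ
    unres  : ∀ {α β γ} → size (α · β) ≤ B → β ⊢ α \\ γ → α · β ⊢ γ
    ∧l₁    : ∀ {α β γ} → size (α ∧ γ) ≤ B → α ⊢ β → α ∧ γ ⊢ β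
    ∧l₂    : ∀ {α β γ} → size (γ ∧ α) ≤ B → α ⊢ β → γ ∧ α ⊢ β
    ∧r     : ∀ {α β γ} → size (β ∧ γ) ≤ B → α ⊢ β → α ⊢ γ → α ⊢ β ∧ γ
    ∨l     : ∀ {α β γ} → size (α ∨ γ) ≤ B → α ⊢ β → γ ⊢ β → α ∨ γ ⊢ β
    ∨r₁    : ∀ {α β γ} → size (β ∨ γ) ≤ B → α ⊢ β → α ⊢ β ∨ γ
    ∨r₂    : ∀ {α β γ} → size (γ ∨ β) ≤ B → α ⊢ β → α ⊢ γ ∨ β
    neg·   : ∀ {α β γ} → size (γ · β) ≤ B → size (¬ α) ≤ B → α · β ⊢ ¬ γ → γ · β ⊢ ¬ α
    neg    : ∀ {α γ} → size (¬ α) ≤ B → α ⊢ ¬ γ → γ ⊢ ¬ α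
    cut    : ∀ {α β γ} → α ⊢ β → β ⊢ γ → α ⊢ γ

-- Structured products, their weights and labels

-- A Pos stands for F₁ · (F₂ · ⋯ (Fₙ · β)).  Its left factors are inert, and an
-- item  frm δ  is the formula δ itself, whereas  grp N δ  is the product N used
-- in the place of a formula δ with N ⇒ ¬ ¬ δ.  A Grp stands for
-- ((β · P₁) · P₂) ⋯ · Pₙ and occurs only below a negation.
mutual
  data Pos : Set where
    ⌊_⌋ : Formula → Pos
    _▹_ : Item → Pos → Pos

  data Item : Set where
    frm : Formula → Item
    grp : Grp → Formula → Item

  data Grp : Set where
    ⌈_⌉ : Formula → Grp
    _⊙_ : Grp → Pos → Grp

infixr 20 _▹_
infixl 20 _⊙_

root : Item → Grp
root (frm δ)   = ⌈ δ ⌉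
root (grp N δ) = N

-- Opens the head factor, which `Neg` exposes when the right-hand side is a negation. The label of
-- the head disappears, and with it the condition `Irrelevant` on that label.
thaw : Pos → Grp
thaw ⌊ β ⌋   = ⌈ β ⌉
thaw (F ▹ P) = root F ⊙ P

label : Item → Formula
label (frm δ)   = δ
label (grp N δ) = δ

mutual
  formᵖ : Pos → Formula
  formᵖ ⌊ β ⌋   = β
  formᵖ (F ▹ P) = formⁱ F · formᵖ P

  formⁱ : Item → Formula
  formⁱ (frm δ)   = δ
  formⁱ (grp N δ) = formⁿ N

  formⁿ : Grp → Formula
  formⁿ ⌈ β ⌉   = β
  formⁿ (N ⊙ P) = formⁿ N · formᵖ P

mutual
  wtᵖ : Pos → ℕ
  wtᵖ ⌊ β ⌋   = wt β
  wtᵖ (F ▹ P) = wtⁱ F + wtᵖ P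

  wtⁱ : Item → ℕ
  wtⁱ (frm δ)   = wt δ
  wtⁱ (grp N δ) = wtⁿ N

  wtⁿ : Grp → ℕ
  wtⁿ ⌈ β ⌉   = wt β
  wtⁿ (N ⊙ P) = wtⁿ N + wtᵖ P

bot : Pos → ℕ
bot ⌊ β ⌋   = wt β
bot (F ▹ P) = bot P

-- The residual of `γ` by `δ` weighs `wt (¬ δ) + wt γ`, so an innermost formula that is to consume
-- every factor of `P` weighs at least `labels P`.
labels : Pos → ℕ
labels ⌊ β ⌋   = 0
labels (F ▹ P) = wt (¬ label F) + labels P

form-root : ∀ F → formⁿ (root F) ≡ formⁱ F
form-root (frm δ)   = refl
form-root (grp N δ) = refl

form-thaw : ∀ P → formⁿ (thaw P) ≡ formᵖ P
form-thaw ⌊ β ⌋   = refl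
form-thaw (F ▹ P) = cong (_· formᵖ P) (form-root F)

wt-root : ∀ F → wtⁿ (root F) ≡ wtⁱ F
wt-root (frm δ)   = refl
wt-root (grp N δ) = refl

wt-thaw : ∀ P → wtⁿ (thaw P) ≡ wtᵖ P
wt-thaw ⌊ β ⌋   = refl
wt-thaw (F ▹ P) = cong (_+ wtᵖ P) (wt-root F)

+-double : ∀ a b → (a + a) + (b + b) ≡ (a + b) + (a + b)
+-double = solve-∀

+-swapʳ : ∀ x p q → x + p + q ≡ x + q + p
+-swapʳ = solve-∀

1+≤double : ∀ {a b} → 0 < b → a ≤ b → suc a ≤ b + b
1+≤double p q = +-mono-≤ p q

double-sum : ∀ {a b} x y → suc a ≤ x + x → suc b ≤ y + y → suc (suc (a + b)) ≤ (x + y) + (x + y)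
double-sum {a} {b} x y p q = subst₂ _≤_ (cong suc (+-suc a b)) (+-double x y) (+-mono-≤ p q)

mutual
  -- `wtᵖ` does not count the products between the factors. There are fewer of these than factors,
  -- and every factor has positive weight, whence the factor two.
  sizeᵖ : ∀ P → suc (size (formᵖ P)) ≤ wtᵖ P + wtᵖ P
  sizeᵖ ⌊ β ⌋   = 1+≤double (0<wt β) (size≤wt β)
  sizeᵖ (F ▹ P) = double-sum (wtⁱ F) (wtᵖ P) (sizeⁱ F) (sizeᵖ P)

  sizeⁱ : ∀ F → suc (size (formⁱ F)) ≤ wtⁱ F + wtⁱ F
  sizeⁱ (frm δ)   = 1+≤double (0<wt δ) (size≤wt δ)
  sizeⁱ (grp N δ) = sizeⁿ N

  sizeⁿ : ∀ N → suc (size (formⁿ N)) ≤ wtⁿ N + wtⁿ N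
  sizeⁿ ⌈ β ⌉   = 1+≤double (0<wt β) (size≤wt β)
  sizeⁿ (N ⊙ P) = double-sum (wtⁿ N) (wtᵖ P) (sizeⁿ N) (sizeᵖ P)

-- Lowering groups to their labels; contexts

infix 4 _≼ⁱ_ _≼_

data _≼ⁱ_ : Item → Item → Set where
  keep  : ∀ {F} → F ≼ⁱ F
  lower : ∀ {N δ} → frm δ ≼ⁱ grp N δ

data _≼_ : Pos → Pos → Set where
  base : ∀ {β} → ⌊ β ⌋ ≼ ⌊ β ⌋
  step : ∀ {F G P Q} → F ≼ⁱ G → P ≼ Q → F ▹ P ≼ G ▹ Q

≼-refl : ∀ {P} → P ≼ P
≼-refl {⌊ β ⌋}  = base
≼-refl {F ▹ P} = step keep ≼-refl

≼-trans : ∀ {P Q R} → P ≼ Q → Q ≼ R → P ≼ R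
≼-trans base base = base
≼-trans (step keep p) (step i q)     = step i (≼-trans p q)
≼-trans (step lower p) (step keep q) = step lower (≼-trans p q)

data Spine : Set where
  []  : Spine
  _▸_ : Spine → Item → Spine

plug : Spine → Pos → Pos
plug [] P      = P
plug (Γ ▸ F) P = plug Γ (F ▹ P)

data Root : Set where
  pos : Formula → Root
  top : Grp → Root

residual : Spine → Formula → Formula
residual [] γ      = γ
residual (Γ ▸ F) γ = formⁱ F \\ residual Γ γ

-- Moving `F` to the right adds `suc (size (formⁱ F))` to the formula there, and by `sizeⁱ` twice
-- the weight of `F` pays for it.
size-residual : ∀ Γ P γ → size (residual Γ γ) + (wtᵖ P + wtᵖ P) ≤ size γ + (wtᵖ (plug Γ P) + wtᵖ (plug Γ P))
size-residual [] P γ      = ≤-refl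
size-residual (Γ ▸ F) P γ = ≤-trans
  (subst₂ _≤_ (push (size (formⁱ F)) r (wtᵖ P + wtᵖ P)) (regroup (wtⁱ F) r (wtᵖ P)) (+-monoˡ-≤ _ (sizeⁱ F)))
  (size-residual Γ (F ▹ P) γ)
  where
  r = size (residual Γ γ)
  push : ∀ a r p → suc a + (r + p) ≡ suc (a + r) + p
  push = solve-∀
  regroup : ∀ w r p → (w + w) + (r + (p + p)) ≡ r + ((w + p) + (w + p))
  regroup = solve-∀

-- Admissible products

module Model (K : ℕ) (_⊢_ : Formula → Formula → Set)
             (closed : Closed ((K + K + K) + (K + K + K)) _⊢_) where
  open Closed closed

  L : ℕ
  L = K + K + K

  Leaf : Formula → ℕ → Set
  Leaf β o = wt β ≤ K × o + wt β ≤ L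

  -- δ can be matched neither by the o units of weight outside, through the right
  -- rule for ·, nor by the innermost formula of P, through the left rule for \\.
  Irrelevant : Formula → Pos → ℕ → Set
  Irrelevant δ P o = o < wt (¬ δ) × bot P < wt (¬ δ) + labels P

  -- o is the weight of the rest of the sequent.  A sequent that is not admissible
  -- counts as holding, so the side conditions must be inherited by premises.
  mutual
    Admᵖ : Pos → ℕ → Set
    Admᵖ ⌊ β ⌋ o   = Leaf β o
    Admᵖ (F ▹ P) o = Admⁱ F P o × Admᵖ P (o + wtⁱ F)

    Admⁱ : Item → Pos → ℕ → Set
    Admⁱ (frm δ) P o   = Leaf δ (o + wtᵖ P)
    Admⁱ (grp N δ) P o = Irrelevant δ P o × Admⁿ N (o + wtᵖ P)

    Admⁿ : Grp → ℕ → Set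
    Admⁿ ⌈ β ⌉ o   = Leaf β o
    Admⁿ (N ⊙ P) o = Admⁿ N (o + wtᵖ P) × Admᵖ P (o + wtⁿ N)

  leaf-≥ : ∀ β {o o′} → o′ ≤ o → Leaf β o → Leaf β o′
  leaf-≥ β h (k , l) = k , ≤-trans (+-monoˡ-≤ (wt β) h) l

  mutual
    admᵖ-≥ : ∀ P {o o′} → o′ ≤ o → Admᵖ P o → Admᵖ P o′
    admᵖ-≥ ⌊ β ⌋ h a         = leaf-≥ β h a
    admᵖ-≥ (F ▹ P) h (a , b) = admⁱ-≥ F P h a , admᵖ-≥ P (+-monoˡ-≤ (wtⁱ F) h) b

    admⁱ-≥ : ∀ F P {o o′} → o′ ≤ o → Admⁱ F P o → Admⁱ F P o′
    admⁱ-≥ (frm δ) P h a               = leaf-≥ δ (+-monoˡ-≤ (wtᵖ P) h) a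
    admⁱ-≥ (grp N δ) P h ((i , j) , a) = (≤-<-trans h i , j) , admⁿ-≥ N (+-monoˡ-≤ (wtᵖ P) h) a

    admⁿ-≥ : ∀ N {o o′} → o′ ≤ o → Admⁿ N o → Admⁿ N o′
    admⁿ-≥ ⌈ β ⌉ h a         = leaf-≥ β h a
    admⁿ-≥ (N ⊙ P) h (a , b) = admⁿ-≥ N (+-monoˡ-≤ (wtᵖ P) h) a , admᵖ-≥ P (+-monoˡ-≤ (wtⁿ N) h) b

  totalᵖ : ∀ P {o} → Admᵖ P o → o + wtᵖ P ≤ L
  totalᵖ ⌊ β ⌋ (_ , l)       = l
  totalᵖ (F ▹ P) {o} (_ , a) = subst (_≤ L) (+-assoc o (wtⁱ F) (wtᵖ P)) (totalᵖ P a)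

  totalⁿ : ∀ N {o} → Admⁿ N o → o + wtⁿ N ≤ L
  totalⁿ ⌈ β ⌉ (_ , l)       = l
  totalⁿ (N ⊙ P) {o} (_ , a) = subst (_≤ L) (+-assoc o (wtⁿ N) (wtᵖ P)) (totalᵖ P a)

  bot-leaf : ∀ P {o} → Admᵖ P o → bot P ≤ K
  bot-leaf ⌊ β ⌋ (k , _)   = k
  bot-leaf (F ▹ P) (_ , a) = bot-leaf P a

  bot≤wt : ∀ P → bot P ≤ wtᵖ P
  bot≤wt ⌊ β ⌋   = ≤-refl
  bot≤wt (F ▹ P) = ≤-trans (bot≤wt P) (m≤n+m (wtᵖ P) (wtⁱ F))

  -- If the labels of P weigh no more than its innermost formula, then each of them
  -- is relevant, so an admissible P contains no grp.
  bottom-bound : ∀ P {o} → Admᵖ P o → labels P ≤ bot P → wtᵖ P ≤ labels P + bot P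
  bottom-bound ⌊ β ⌋ a h = ≤-refl
  bottom-bound (frm δ ▹ P) (_ , a) h = subst (wt δ + wtᵖ P ≤_) (sym (+-assoc (wt (¬ δ)) (labels P) (bot P)))
    (+-mono-≤ (≤-trans (m≤m+n (wt δ) (wt δ)) (n≤1+n _)) (bottom-bound P a (m+n≤o⇒n≤o (wt (¬ δ)) h)))
  bottom-bound (grp N δ ▹ P) (((_ , j) , _) , _) h = ⊥-elim (<⇒≱ j h)

  -- With no `grp` in `P`, admissibility only bounds each leaf by `K` and the total by `L`, so the
  -- outer weight may change, even grow, as long as the total stays within `L`.
  bottom-adm : ∀ P {o o′} → Admᵖ P o → labels P ≤ bot P → o′ + wtᵖ P ≤ L → Admᵖ P o′
  bottom-adm ⌊ β ⌋ (k , _) h l = k , l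
  bottom-adm (frm δ ▹ P) {o} {o′} ((k , _) , a) h l =
    (k , subst (_≤ L) (e o′ (wt δ) (wtᵖ P)) l) ,
    bottom-adm P a (m+n≤o⇒n≤o (wt (¬ δ)) h) (subst (_≤ L) (sym (+-assoc o′ (wt δ) (wtᵖ P))) l)
    where
    e : ∀ o d p → o + (d + p) ≡ o + p + d
    e = solve-∀
  bottom-adm (grp N δ ▹ P) (((_ , j) , _) , _) h = ⊥-elim (<⇒≱ j h)

  -- Orthogonality and validity of admissible sequents

  infix 4 _⊥_ _⊩_ _⊩_∣_

  _⊥_ : Grp → Grp → Set
  N ⊥ M = Admⁿ N (wtⁿ M) → Admⁿ M (wtⁿ N) → formⁿ N ⊢ ¬ formⁿ M

  _⊩_ : Pos → Root → Set
  P ⊩ pos ε = Admᵖ P (wt ε) → wt ε ≤ K → formᵖ P ⊢ ε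
  P ⊩ top M = thaw P ⊥ M

  _⊩_∣_ : Pos → Spine → Root → Set
  P ⊩ Γ ∣ R = plug Γ P ⊩ R

  L≤B : L ≤ L + L
  L≤B = m≤m+n L L

  K≤L : K ≤ L
  K≤L = ≤-trans (m≤m+n K K) (m≤m+n (K + K) K)

  small-wt : ∀ α → wt α ≤ K → size α ≤ L + L
  small-wt α h = ≤-trans (size≤wt α) (≤-trans h (≤-trans K≤L L≤B))

  small-pair : ∀ {a b} x y → suc a ≤ x + x → suc b ≤ y + y → x + y ≤ L → suc (a + b) ≤ L + L
  small-pair x y p q h = ≤-trans (n≤1+n _) (≤-trans (double-sum x y p q) (+-mono-≤ h h))

  small-one : ∀ {a} x y → suc a ≤ x + x → y + x ≤ L → suc a ≤ L + L
  small-one x y p h = ≤-trans p (+-mono-≤ h′ h′)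
    where h′ = ≤-trans (m≤n+m x y) h

  ⊥-sym : ∀ {N M} → N ⊥ M → M ⊥ N
  ⊥-sym {N} {M} d a b = neg (small-one (wtⁿ N) (wtⁿ M) (sizeⁿ N) (totalⁿ N b)) (d b a)

  -- Each of `N`, `P`, `M` is weighed against the other two in both sequents, so the conditions of
  -- admissibility coincide and `neg·` applies.
  ⊥-rotate : ∀ {N P M} → N ⊙ P ⊥ M → M ⊙ P ⊥ N
  ⊥-rotate {N} {P} {M} d (a , b) c =
    neg· (small-pair (wtⁿ M) (wtᵖ P) (sizeⁿ M) (sizeᵖ P)
            (≤-trans (m≤n+m (wtⁿ M + wtᵖ P) (wtⁿ N)) (totalⁿ (M ⊙ P) (a , b))))
         (small-one (wtⁿ N) (wtⁿ M + wtᵖ P) (sizeⁿ N) (totalⁿ N c))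
         (d (c , subst (Admᵖ P) (+-comm (wtⁿ N) (wtⁿ M)) b) a)

  ¬¬-intro : ∀ {ε} → size (¬ ¬ ε) ≤ L + L → ε ⊢ ¬ ¬ ε
  ¬¬-intro s = neg s (ident (≤-trans (n≤1+n _) s))

  -- Neg exchanges n with m and so brings δ to the right of ⊢, where Cut applies.
  swap-factor : ∀ {δ p m n} → size (m · p) ≤ L + L → size (¬ δ) ≤ L + L → size (n · p) ≤ L + L →
                size (¬ n) ≤ L + L → size (¬ m) ≤ L + L →
                δ · p ⊢ ¬ m → n ⊢ ¬ ¬ δ → n · p ⊢ ¬ m
  swap-factor mp ¬δ np ¬n ¬m d e = neg· np ¬m (cut (neg· mp ¬δ d) (neg ¬n e))

  plug-≥ : ∀ Γ P → wtᵖ P ≤ wtᵖ (plug Γ P)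
  plug-≥ [] P      = ≤-refl
  plug-≥ (Γ ▸ F) P = ≤-trans (m≤n+m (wtᵖ P) (wtⁱ F)) (plug-≥ Γ (F ▹ P))

  small-plug : ∀ Γ P o → o + wtᵖ (plug Γ P) ≤ L → size (formᵖ P) ≤ L + L
  small-plug Γ P o h = ≤-trans (n≤1+n _) (≤-trans (sizeᵖ P) (+-mono-≤ h′ h′))
    where h′ = ≤-trans (plug-≥ Γ P) (≤-trans (m≤n+m _ o) h)

  small-residual : ∀ Γ P o γ → size γ ≤ o + o → o + wtᵖ (plug Γ P) ≤ L → size (residual Γ γ) ≤ L + L
  small-residual Γ P o γ s h = ≤-trans (m≤m+n _ _) (≤-trans (size-residual Γ P γ)
    (≤-trans (+-monoˡ-≤ (w + w) s) (≤-trans (≤-reflexive (+-double o w)) (+-mono-≤ h h))))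
    where w = wtᵖ (plug Γ P)

  to-residual : ∀ Γ P o γ → size γ ≤ o + o → o + wtᵖ (plug Γ P) ≤ L →
                formᵖ (plug Γ P) ⊢ γ → formᵖ P ⊢ residual Γ γ
  to-residual [] P o γ s h d      = d
  to-residual (Γ ▸ F) P o γ s h d = res (small-residual (Γ ▸ F) P o γ s h) (to-residual Γ (F ▹ P) o γ s h d)

  from-residual : ∀ Γ P o γ → o + wtᵖ (plug Γ P) ≤ L → formᵖ P ⊢ residual Γ γ → formᵖ (plug Γ P) ⊢ γ
  from-residual [] P o γ h d      = d
  from-residual (Γ ▸ F) P o γ h d = from-residual Γ (F ▹ P) o γ h (unres (small-plug Γ (F ▹ P) o h) d)

  -- Left rules inside a context

  infix 4 _⊒_

  -- `P` is the conclusion side of a left rule and `Q` the premise side. `bottom` compares the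
  -- excess of `bot` over `labels`, which must not grow if a label irrelevant in front of `P` is to
  -- remain so in front of `Q`.
  record _⊒_ (P Q : Pos) : Set where
    field
      weight   : wtᵖ Q ≤ wtᵖ P
      bottom   : bot Q + labels P ≤ bot P + labels Q
      adm      : ∀ {o} → Admᵖ P o → Admᵖ Q o
      adm-thaw : ∀ {o} → Admⁿ (thaw P) o → Admⁿ (thaw Q) o
  open _⊒_

  +-swap : ∀ x a b → a + (x + b) ≡ x + (a + b)
  +-swap = solve-∀

  ▹-⊒ : ∀ F {P Q} → P ⊒ Q → F ▹ P ⊒ F ▹ Q
  ▹-⊒ F {P} {Q} r = record
    { weight   = +-monoʳ-≤ (wtⁱ F) (weight r)
    ; bottom   = subst₂ _≤_ (sym (+-swap x (bot Q) (labels P))) (sym (+-swap x (bot P) (labels Q)))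
                   (+-monoʳ-≤ x (bottom r))
    ; adm      = λ (i , a) → item F i , adm r a
    ; adm-thaw = λ {o} (a , b) → admⁿ-≥ (root F) (+-monoʳ-≤ o (weight r)) a , adm r b
    }
    where
    x = wt (¬ label F)
    item : ∀ F {o} → Admⁱ F P o → Admⁱ F Q o
    item (frm δ) {o} a = leaf-≥ δ (+-monoʳ-≤ o (weight r)) a
    item (grp N δ) {o} ((i , j) , a) =
      (i , +-cancelʳ-< (labels P) (bot Q) (wt (¬ δ) + labels Q)
             (≤-<-trans (bottom r) (<-≤-trans (+-monoˡ-< (labels Q) j)
               (≤-reflexive (+-swapʳ (wt (¬ δ)) (labels P) (labels Q)))))) ,
      admⁿ-≥ N (+-monoʳ-≤ o (weight r)) a

  plug-⊒ : ∀ Γ {P Q} → P ⊒ Q → plug Γ P ⊒ plug Γ Q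
  plug-⊒ [] r      = r
  plug-⊒ (Γ ▸ F) r = plug-⊒ Γ (▹-⊒ F r)

  -- The context is carried to the right as a residual, the rule is applied to the exposed formulas,
  -- and the context is brought back.
  left₂ : ∀ {P Q₁ Q₂} → P ⊒ Q₁ → P ⊒ Q₂ →
          (∀ {γ} → size (formᵖ P) ≤ L + L → formᵖ Q₁ ⊢ γ → formᵖ Q₂ ⊢ γ → formᵖ P ⊢ γ) →
          ∀ Γ R → Q₁ ⊩ Γ ∣ R → Q₂ ⊩ Γ ∣ R → P ⊩ Γ ∣ R
  left₂ {P} {Q₁} {Q₂} r₁ r₂ rule Γ = go
    where
    core : ∀ o γ → size γ ≤ o + o → o + wtᵖ (plug Γ P) ≤ L →
           formᵖ (plug Γ Q₁) ⊢ γ → formᵖ (plug Γ Q₂) ⊢ γ → formᵖ (plug Γ P) ⊢ γ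
    core o γ s h d₁ d₂ = from-residual Γ P o γ h (rule (small-plug Γ P o h)
      (to-residual Γ Q₁ o γ s (≤-trans (+-monoʳ-≤ o (weight (plug-⊒ Γ r₁))) h) d₁)
      (to-residual Γ Q₂ o γ s (≤-trans (+-monoʳ-≤ o (weight (plug-⊒ Γ r₂))) h) d₂))
    outer : ∀ M {Q} → P ⊒ Q → Admⁿ M (wtⁿ (thaw (plug Γ P))) → Admⁿ M (wtⁿ (thaw (plug Γ Q)))
    outer M {Q} r = admⁿ-≥ M (subst₂ _≤_ (sym (wt-thaw (plug Γ Q))) (sym (wt-thaw (plug Γ P))) (weight (plug-⊒ Γ r)))
    unthaw : ∀ P {γ} → formⁿ (thaw P) ⊢ γ → formᵖ P ⊢ γ
    unthaw P {γ} = subst (_⊢ γ) (form-thaw P)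
    go : ∀ R → Q₁ ⊩ Γ ∣ R → Q₂ ⊩ Γ ∣ R → P ⊩ Γ ∣ R
    go (pos ε) d₁ d₂ a k = core (wt ε) ε (≤-trans (size≤wt ε) (m≤m+n _ _)) (totalᵖ (plug Γ P) a)
      (d₁ (adm (plug-⊒ Γ r₁) a) k) (d₂ (adm (plug-⊒ Γ r₂) a) k)
    go (top M) d₁ d₂ a b = subst (_⊢ ¬ formⁿ M) (sym (form-thaw (plug Γ P)))
      (core (wtⁿ M) (¬ formⁿ M) (sizeⁿ M)
        (subst (λ w → wtⁿ M + w ≤ L) (wt-thaw (plug Γ P)) (totalⁿ (thaw (plug Γ P)) a))
        (unthaw (plug Γ Q₁) (d₁ (adm-thaw (plug-⊒ Γ r₁) a) (outer M r₁ b)))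
        (unthaw (plug Γ Q₂) (d₂ (adm-thaw (plug-⊒ Γ r₂) a) (outer M r₂ b))))

  left₁ : ∀ {P Q} → P ⊒ Q → (∀ {γ} → size (formᵖ P) ≤ L + L → formᵖ Q ⊢ γ → formᵖ P ⊢ γ) →
          ∀ Γ R → Q ⊩ Γ ∣ R → P ⊩ Γ ∣ R
  left₁ r rule Γ R d = left₂ r r (λ s d _ → rule s d) Γ R d d

  ⌊⌋-⊒ : ∀ {α β} → wt β ≤ wt α → ⌊ α ⌋ ⊒ ⌊ β ⌋
  ⌊⌋-⊒ {α} {β} h = record
    { weight = h ; bottom = +-monoˡ-≤ 0 h ; adm = leaf ; adm-thaw = leaf }
    where
    leaf : ∀ {o} → Leaf α o → Leaf β o
    leaf {o} (k , l) = ≤-trans h k , ≤-trans (+-monoʳ-≤ o h) l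

  wt≤¬ : ∀ α → wt α ≤ wt (¬ α)
  wt≤¬ α = ≤-trans (m≤m+n (wt α) (wt α)) (n≤1+n _)

  ·-⊒ : ∀ {α β} → ⌊ α · β ⌋ ⊒ frm α ▹ ⌊ β ⌋
  ·-⊒ {α} {β} = record
    { weight = sum ; bottom = +-mono-≤ (m≤n+m (wt β) (wt (¬ α))) (z≤n {labels (frm α ▹ ⌊ β ⌋)}) ; adm = leaf ; adm-thaw = leaf }
    where
    sum : wt α + wt β ≤ wt (α · β)
    sum = +-monoˡ-≤ (wt β) (wt≤¬ α)
    leaf : ∀ {o} → Leaf (α · β) o → Leaf α (o + wt β) × Leaf β (o + wt α)
    leaf {o} (k , l) =
      (≤-trans (≤-trans (m≤m+n (wt α) (wt β)) sum) k , subst (_≤ L) (e o (wt α) (wt β)) l′) ,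
      (≤-trans (≤-trans (m≤n+m (wt β) (wt α)) sum) k , subst (_≤ L) (sym (+-assoc o (wt α) (wt β))) l′)
      where
      e : ∀ o a b → o + (a + b) ≡ o + b + a
      e = solve-∀
      l′ = ≤-trans (+-monoʳ-≤ o sum) l

  \\-⊒ : ∀ {α γ} → frm α ▹ ⌊ α \\ γ ⌋ ⊒ ⌊ γ ⌋
  \\-⊒ {α} {γ} = record
    { weight = ≤-trans le (m≤n+m (wt (α \\ γ)) (wt α))
    -- Nothing is lost: the innermost formula and the labels both shrink by `wt (¬ α)`.
    ; bottom = ≤-reflexive (e (wt γ) (wt (¬ α)))
    ; adm = λ (_ , a) → leaf a ; adm-thaw = λ (_ , a) → leaf a }
    where
    e : ∀ g x → g + (x + 0) ≡ x + g + 0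
    e = solve-∀
    le : wt γ ≤ wt (α \\ γ)
    le = m≤n+m (wt γ) (wt (¬ α))
    leaf : ∀ {o} → Leaf (α \\ γ) (o + wt α) → Leaf γ o
    leaf {o} (k , l) = ≤-trans le k , ≤-trans (+-mono-≤ (m≤m+n o (wt α)) le) l

  ∧-left₁ : ∀ {α β} Γ R → ⌊ α ⌋ ⊩ Γ ∣ R → ⌊ α ∧ β ⌋ ⊩ Γ ∣ R
  ∧-left₁ {α} {β} = left₁ (⌊⌋-⊒ (≤-trans (m≤m+n (wt α) (wt β)) (n≤1+n _))) ∧l₁

  ∧-left₂ : ∀ {α β} Γ R → ⌊ β ⌋ ⊩ Γ ∣ R → ⌊ α ∧ β ⌋ ⊩ Γ ∣ R
  ∧-left₂ {α} {β} = left₁ (⌊⌋-⊒ (≤-trans (m≤n+m (wt β) (wt α)) (n≤1+n _))) ∧l₂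

  ∨-left : ∀ {α β} Γ R → ⌊ α ⌋ ⊩ Γ ∣ R → ⌊ β ⌋ ⊩ Γ ∣ R → ⌊ α ∨ β ⌋ ⊩ Γ ∣ R
  ∨-left {α} {β} = left₂ (⌊⌋-⊒ (≤-trans (m≤m+n (wt α) (wt β)) (n≤1+n _)))
                         (⌊⌋-⊒ (≤-trans (m≤n+m (wt β) (wt α)) (n≤1+n _))) ∨l

  ·-left : ∀ {α β} Γ R → frm α ▹ ⌊ β ⌋ ⊩ Γ ∣ R → ⌊ α · β ⌋ ⊩ Γ ∣ R
  ·-left = left₁ ·-⊒ (λ _ d → d)

  eval : ∀ {α γ} → size (α · (α \\ γ)) ≤ L + L → α · (α \\ γ) ⊢ γ
  eval {α} {γ} s = unres s (ident (≤-trans (m≤n+m _ (suc (size α))) s))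

  \\-left : ∀ {α γ} Γ R → ⌊ γ ⌋ ⊩ Γ ∣ R → frm α ▹ ⌊ α \\ γ ⌋ ⊩ Γ ∣ R
  \\-left = left₁ \\-⊒ (λ s d → cut (eval s) d)

  adm-plug : ∀ Γ P {o} → Admᵖ (plug Γ P) o → ∃ (Admᵖ P)
  adm-plug [] P a      = _ , a
  adm-plug (Γ ▸ F) P a = _ , proj₂ (proj₂ (adm-plug Γ (F ▹ P) a))

  adm-plug-thaw : ∀ Γ F P {o} → Admⁿ (thaw (plug Γ (F ▹ P))) o → ∃ (Admᵖ P)
  adm-plug-thaw [] F P a      = _ , proj₂ a
  adm-plug-thaw (Γ ▸ G) F P a = _ , proj₂ (proj₂ (adm-plug-thaw Γ G (F ▹ P) a))

  -- The innermost formula outweighs `¬ α`, so the label `α` is relevant and the sequent is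
  -- inadmissible unless the group gets thawed. That happens only for an empty context and root
  -- `top M`, where `swap-factor` exchanges `N` for `α`.
  \\-left-grp : ∀ {N α γ} → N ⊥ ⌈ ¬ α ⌉ → ∀ Γ R → ⌊ γ ⌋ ⊩ Γ ∣ R → grp N α ▹ ⌊ α \\ γ ⌋ ⊩ Γ ∣ R
  \\-left-grp {N} {α} {γ} n = go
    where
    P = grp N α ▹ ⌊ α \\ γ ⌋
    absurd : ∀ {X : Set} → ∃ (Admᵖ P) → X
    absurd (_ , ((_ , j) , _) , _) = ⊥-elim (<⇒≱ j (+-monoʳ-≤ (wt (¬ α)) z≤n))
    go : ∀ Γ R → ⌊ γ ⌋ ⊩ Γ ∣ R → P ⊩ Γ ∣ R
    go Γ (pos ε) d a       = absurd (adm-plug Γ P a)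
    go (Γ ▸ F) (top M) d a = absurd (adm-plug-thaw Γ F P a)
    go [] (top M) d (a , k , l) b = swap-factor
      (small-pair (wtⁿ M) w (sizeⁿ M) (sizeᵖ ⌊ α \\ γ ⌋) (≤-trans (+-monoˡ-≤ w (m≤m+n (wtⁿ M) (wtⁿ N))) l))
      (small-wt (¬ α) ¬α≤K)
      (small-pair (wtⁿ N) w (sizeⁿ N) (sizeᵖ ⌊ α \\ γ ⌋) (≤-trans (+-monoˡ-≤ w (m≤n+m (wtⁿ N) (wtⁿ M))) l))
      (small-one (wtⁿ N) (wtⁿ M + w) (sizeⁿ N) (totalⁿ N a))
      (small-one (wtⁿ M) (wtⁿ N + w) (sizeⁿ M) (totalⁿ M b))
      (cut (eval (small-pair (wt α) w (sizeᵖ ⌊ α ⌋) (sizeᵖ ⌊ α \\ γ ⌋)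
              (≤-trans (+-mono-≤ (≤-trans (≤-trans (wt≤¬ α) ¬α≤w) k) k) (m≤m+n (K + K) K))))
           (d (≤-trans γ≤w k , ≤-trans (+-mono-≤ (m≤m+n (wtⁿ M) (wtⁿ N)) γ≤w) l)
              (admⁿ-≥ M (≤-trans γ≤w (m≤n+m w (wtⁿ N))) b)))
      (n (admⁿ-≥ N (≤-trans ¬α≤w (m≤n+m w (wtⁿ M))) a)
         (¬α≤K , ≤-trans (+-mono-≤ (m≤n+m (wtⁿ N) (wtⁿ M)) ¬α≤w) l))
      where
      w = wt (α \\ γ)
      ¬α≤w : wt (¬ α) ≤ w
      ¬α≤w = m≤m+n (wt (¬ α)) (wt γ)
      γ≤w : wt γ ≤ w
      γ≤w = m≤n+m (wt γ) (wt (¬ α))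
      ¬α≤K = ≤-trans ¬α≤w k

  admⁿ-root : ∀ F P {o} → Admⁱ F P o → Admⁿ (root F) (o + wtᵖ P)
  admⁿ-root (frm δ) P a         = a
  admⁿ-root (grp N δ) P (_ , a) = a

  admⁿ-thaw : ∀ P {o} → Admᵖ P o → Admⁿ (thaw P) o
  admⁿ-thaw ⌊ β ⌋ a             = a
  admⁿ-thaw (F ▹ P) {o} (a , b) = admⁿ-root F P a , subst (λ w → Admᵖ P (o + w)) (sym (wt-root F)) b

  -- Right rules

  \\-right : ∀ {P α γ} → frm α ▹ P ⊩ pos γ → P ⊩ pos (α \\ γ)
  \\-right {P} {α} {γ} d a k = res (small-wt (α \\ γ) k)
    (d ((≤-trans (≤-trans (m≤m+n (wt α) (wt γ)) le) k ,
         ≤-trans (≤-reflexive (e (wt γ) (wtᵖ P) (wt α))) (≤-trans (+-monoˡ-≤ (wtᵖ P) le) (totalᵖ P a))) ,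
        admᵖ-≥ P (≤-trans (≤-reflexive (+-comm (wt γ) (wt α))) le) a)
       (≤-trans (≤-trans (m≤n+m (wt γ) (wt α)) le) k))
    where
    e : ∀ g p a → g + p + a ≡ a + g + p
    e = solve-∀
    le : wt α + wt γ ≤ wt (α \\ γ)
    le = +-monoˡ-≤ (wt γ) (wt≤¬ α)

  -- For a formula `α` this is monotonicity of `·` in its right argument, obtained by residuation
  -- and `cut`. For a group the label is relevant to the product on the right, so nothing is
  -- admissible.
  ·-right : ∀ {F P β} → P ⊩ pos β → F ▹ P ⊩ pos (label F · β)
  ·-right {frm α} {P} {β} d ((_ , l) , a) k = unres small
      (cut (d (admᵖ-≥ P (≤-trans β≤ (m≤m+n _ _)) a) (≤-trans β≤ k))
           (res small-res (ident (small-wt (α · β) k))))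
    where
    β≤ : wt β ≤ wt (α · β)
    β≤ = m≤n+m (wt β) (wt (¬ α))
    small : size (α · formᵖ P) ≤ L + L
    small = small-pair (wt α) (wtᵖ P) (sizeᵖ ⌊ α ⌋) (sizeᵖ P)
      (≤-trans (≤-reflexive (+-comm (wt α) (wtᵖ P))) (≤-trans (+-monoˡ-≤ (wt α) (m≤n+m (wtᵖ P) (wt (α · β)))) l))
    small-res : size (α \\ α · β) ≤ L + L
    small-res = small-pair (wt α) (wt (α · β)) (sizeᵖ ⌊ α ⌋) (sizeᵖ ⌊ α · β ⌋)
      (≤-trans (+-mono-≤ (≤-trans (≤-trans (wt≤¬ α) (m≤m+n (wt (¬ α)) (wt β))) k) k) (m≤m+n (K + K) K))
  ·-right {grp N α} {P} {β} d (((i , _) , _) , _) = ⊥-elim (<⇒≱ i (m≤m+n (wt (¬ α)) (wt β)))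

  ∨-right₁ : ∀ {P α β} → P ⊩ pos α → P ⊩ pos (α ∨ β)
  ∨-right₁ {P} {α} {β} d a k = ∨r₁ (small-wt (α ∨ β) k) (d (admᵖ-≥ P le a) (≤-trans le k))
    where
    le : wt α ≤ wt (α ∨ β)
    le = ≤-trans (m≤m+n (wt α) (wt β)) (n≤1+n _)

  ∨-right₂ : ∀ {P α β} → P ⊩ pos β → P ⊩ pos (α ∨ β)
  ∨-right₂ {P} {α} {β} d a k = ∨r₂ (small-wt (α ∨ β) k) (d (admᵖ-≥ P le a) (≤-trans le k))
    where
    le : wt β ≤ wt (α ∨ β)
    le = ≤-trans (m≤n+m (wt β) (wt α)) (n≤1+n _)

  ∧-right : ∀ {P α β} → P ⊩ pos α → P ⊩ pos β → P ⊩ pos (α ∧ β)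
  ∧-right {P} {α} {β} d e a k = ∧r (small-wt (α ∧ β) k)
    (d (admᵖ-≥ P le₁ a) (≤-trans le₁ k)) (e (admᵖ-≥ P le₂ a) (≤-trans le₂ k))
    where
    le₁ : wt α ≤ wt (α ∧ β)
    le₁ = ≤-trans (m≤m+n (wt α) (wt β)) (n≤1+n _)
    le₂ : wt β ≤ wt (α ∧ β)
    le₂ = ≤-trans (m≤n+m (wt β) (wt α)) (n≤1+n _)

  ¬-right : ∀ {P γ} → thaw P ⊥ ⌈ γ ⌉ → P ⊩ pos (¬ γ)
  ¬-right {P} {γ} d a k = subst (_⊢ ¬ γ) (form-thaw P)
    (d (admⁿ-≥ (thaw P) (wt≤¬ γ) (admⁿ-thaw P a))
       (≤-trans (wt≤¬ γ) k ,
        ≤-trans (≤-reflexive (+-comm (wtⁿ (thaw P)) (wt γ)))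
          (≤-trans (+-monoˡ-≤ (wtⁿ (thaw P)) (wt≤¬ γ)) (totalⁿ (thaw P) (admⁿ-thaw P a)))))

  -- Negation on the left

  -- The requirement `N ⇒ ¬ ¬ δ` stops at the head, since only the head is ever exchanged for its
  -- label by `swap-factor`.
  HeadValid : Pos → Set
  HeadValid ⌊ β ⌋           = ⊤
  HeadValid (frm δ ▹ P)   = ⊤
  HeadValid (grp N δ ▹ P) = N ⊥ ⌈ ¬ δ ⌉

  -- For a head grp N δ with δ irrelevant the hypothesis on P itself applies.
  -- Otherwise it is vacuous, and one replaces N by δ, that is, P by a P′ ≼ P.
  ¬-left : ∀ {P ε} → HeadValid P → (∀ {P′} → P′ ≼ P → P′ ⊩ pos ε) → thaw P ⊥ ⌈ ¬ ε ⌉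
  ¬-left {P} {ε} v d a (k , l) = go P v d a
    where
    ε≤K : wt ε ≤ K
    ε≤K = ≤-trans (wt≤¬ ε) k
    small-¬¬ : size (¬ ¬ ε) ≤ L + L
    small-¬¬ = ≤-trans (sizeᵖ ⌊ ¬ ε ⌋) (+-mono-≤ (≤-trans k K≤L) (≤-trans k K≤L))
    module Relevant N δ P (v : N ⊥ ⌈ ¬ δ ⌉) (d : ∀ {P′} → P′ ≼ grp N δ ▹ P → P′ ⊩ pos ε)
                    (a : Admⁿ N (wt (¬ ε) + wtᵖ P)) (b : Admᵖ P (wt (¬ ε) + wtⁿ N)) where
      relevant : wt (¬ δ) ≤ K → wt (¬ δ) ≤ wt (¬ ε) + wtᵖ P → Admᵖ (frm δ ▹ P) (wt ε) → formⁿ N · formᵖ P ⊢ ¬ ¬ ε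
      relevant k′ h c = swap-factor
        (small-pair (wt (¬ ε)) (wtᵖ P) (sizeᵖ ⌊ ¬ ε ⌋) (sizeᵖ P) (≤-trans (m≤m+n _ (wtⁿ N)) (totalⁿ N a)))
        (small-wt (¬ δ) k′)
        (small-pair (wtⁿ N) (wtᵖ P) (sizeⁿ N) (sizeᵖ P)
          (≤-trans (+-monoˡ-≤ (wtᵖ P) (m≤n+m (wtⁿ N) (wt (¬ ε)))) (totalᵖ P b)))
        (small-one (wtⁿ N) (wt (¬ ε) + wtᵖ P) (sizeⁿ N) (totalⁿ N a))
        small-¬¬
        (cut (d (step lower ≼-refl) c ε≤K) (¬¬-intro small-¬¬))
        (v (admⁿ-≥ N h a)
           (k′ , ≤-trans (≤-reflexive (+-comm (wtⁿ N) (wt (¬ δ)))) (≤-trans (+-monoˡ-≤ (wtⁿ N) h) (totalⁿ N a))))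
    go : ∀ P → HeadValid P → (∀ {P′} → P′ ≼ P → P′ ⊩ pos ε) → Admⁿ (thaw P) (wt (¬ ε)) →
         formⁿ (thaw P) ⊢ ¬ ¬ ε
    go ⌊ β ⌋ v d a = cut (d base (leaf-≥ β (wt≤¬ ε) a) ε≤K) (¬¬-intro small-¬¬)
    go (frm δ ▹ P) v d (a , b) = cut (d ≼-refl (admᵖ-≥ (frm δ ▹ P) (wt≤¬ ε) (a , b)) ε≤K) (¬¬-intro small-¬¬)
    go (grp N δ ▹ P) v d (a , b) with wt (¬ δ) ≤? wt ε | wt (¬ δ) + labels P ≤? bot P
    ... | no i | no j = cut (d ≼-refl
            (((≰⇒> i , ≰⇒> j) , admⁿ-≥ N (+-monoˡ-≤ (wtᵖ P) (wt≤¬ ε)) a) , admᵖ-≥ P (+-monoˡ-≤ (wtⁿ N) (wt≤¬ ε)) b)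
            ε≤K) (¬¬-intro small-¬¬)
    ... | yes i | _ = relevant (≤-trans i ε≤K) (≤-trans i (≤-trans (wt≤¬ ε) (m≤m+n _ _)))
          ((≤-trans (wt≤¬ δ) (≤-trans i ε≤K) ,
            ≤-trans (≤-reflexive (+-swapʳ (wt ε) (wtᵖ P) (wt δ)))
              (≤-trans (+-monoˡ-≤ (wtᵖ P) le) (≤-trans (m≤m+n _ (wtⁿ N)) (totalⁿ N a)))) ,
           admᵖ-≥ P (≤-trans le (m≤m+n _ (wtⁿ N))) b)
      where
      open Relevant N δ P v d a b
      le : wt ε + wt δ ≤ wt (¬ ε)
      le = ≤-trans (+-monoʳ-≤ (wt ε) (≤-trans (wt≤¬ δ) i)) (n≤1+n _)
    -- This case dictates `L = 3K`: each of `wt ε`, `wt (¬ δ) + labels P` and `bot P` is at most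
    -- `K`. The outer weight may have grown, so `P` is readmitted by `bottom-adm`.
    ... | no _ | yes j = relevant (≤-trans ¬δ≤bot bot≤K) (≤-trans ¬δ≤bot (≤-trans (bot≤wt P) (m≤n+m _ (wt (¬ ε)))))
          ((≤-trans (wt≤¬ δ) (≤-trans ¬δ≤bot bot≤K) , subst (_≤ L) (+-swapʳ (wt ε) (wt δ) (wtᵖ P)) le) ,
           bottom-adm P b labels≤bot le)
      where
      open Relevant N δ P v d a b
      bot≤K : bot P ≤ K
      bot≤K = bot-leaf P b
      ¬δ≤bot : wt (¬ δ) ≤ bot P
      ¬δ≤bot = m+n≤o⇒m≤o (wt (¬ δ)) j
      labels≤bot : labels P ≤ bot P
      labels≤bot = m+n≤o⇒n≤o (wt (¬ δ)) j
      regroup : ∀ e d l b → e + d + (l + b) ≡ e + (d + l) + b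
      regroup = solve-∀
      le : wt ε + wt δ + wtᵖ P ≤ L
      le = ≤-trans (+-mono-≤ (+-monoʳ-≤ (wt ε) (wt≤¬ δ)) (bottom-bound P b labels≤bot))
        (≤-trans (≤-reflexive (regroup (wt ε) (wt (¬ δ)) (labels P) (bot P)))
          (+-mono-≤ (+-mono-≤ ε≤K (≤-trans j bot≤K)) bot≤K))

  -- Interpretation of formulas

  Perp : (Pos → Set) → Grp → Set
  Perp X N = ∀ {Q} → X Q → N ⊥ thaw Q

  -- What may stand for `α` on the left of a product: `α` itself, or a group that lies in the
  -- biorthogonal of `X` and entails `¬ ¬ α`.
  data Factor (X : Pos → Set) (α : Formula) : Item → Set where
    exact : Factor X α (frm α)
    group : ∀ {N} → (∀ {M} → Perp X M → N ⊥ M) → N ⊥ ⌈ ¬ α ⌉ → Factor X α (grp N α)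

  data Product (X : Pos → Set) (α : Formula) (Y : Pos → Set) : Pos → Set where
    prod : ∀ {F P} → Factor X α F → Y P → Product X α Y (F ▹ P)

  -- A Galois closure whose tests are the pairs of a context and a root, made stable under `≼`
  -- because a group may have to be lowered to its label.
  record Closure (X : Pos → Set) (P : Pos) : Set where
    constructor closure
    field
      valid  : HeadValid P
      member : ∀ Γ R → (∀ {Q} → X Q → Q ⊩ Γ ∣ R) → ∀ {P′} → P′ ≼ P → P′ ⊩ Γ ∣ R

  -- The clause for the residual ranges over `Factor` and not over all of `⟦ α ⟧`, since `·` is not
  -- even congruent on the left.
  ⟦_⟧ : Formula → Pos → Set
  ⟦ var n ⟧ P  = HeadValid P × (∀ {P′} → P′ ≼ P → P′ ⊩ pos (var n))
  ⟦ α · β ⟧ P  = Closure (Product ⟦ α ⟧ α ⟦ β ⟧) P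
  ⟦ α \\ β ⟧ P = HeadValid P × (∀ {F} → Factor ⟦ α ⟧ α F → ⟦ β ⟧ (F ▹ P))
  ⟦ α ∧ β ⟧ P  = ⟦ α ⟧ P × ⟦ β ⟧ P
  ⟦ α ∨ β ⟧ P  = Closure (λ Q → ⟦ α ⟧ Q ⊎ ⟦ β ⟧ Q) P
  ⟦ ¬ α ⟧ P    = HeadValid P × (∀ {P′} → P′ ≼ P → Perp ⟦ α ⟧ (thaw P′))

  factor-label : ∀ {X α F} → Factor X α F → label F ≡ α
  factor-label exact       = refl
  factor-label (group _ _) = refl

  factor-valid : ∀ {X α F P} → Factor X α F → HeadValid (F ▹ P)
  factor-valid exact       = tt
  factor-valid (group _ v) = v

  factor-≼ : ∀ {X α F G} → F ≼ⁱ G → Factor X α G → Factor X α F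
  factor-≼ keep x            = x
  factor-≼ lower (group _ _) = exact

  valid-≼ : ∀ {P Q} → P ≼ Q → HeadValid Q → HeadValid P
  valid-≼ base v = v
  valid-≼ (step {frm _} keep _) v   = v
  valid-≼ (step {grp _ _} keep _) v = v
  valid-≼ (step lower _) v          = tt

  ⟦⟧-valid : ∀ α {P} → ⟦ α ⟧ P → HeadValid P
  ⟦⟧-valid (var n) (v , _)      = v
  ⟦⟧-valid (α · β) (closure v _) = v
  ⟦⟧-valid (α \\ β) (v , _)     = v
  ⟦⟧-valid (α ∧ β) (x , _)      = ⟦⟧-valid α x
  ⟦⟧-valid (α ∨ β) (closure v _) = v
  ⟦⟧-valid (¬ α) (v , _)        = v

  closure-≼ : ∀ {X P Q} → P ≼ Q → Closure X Q → Closure X P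
  closure-≼ h (closure v m) = closure (valid-≼ h v) (λ Γ R c h′ → m Γ R c (≼-trans h′ h))

  closure-mono : ∀ {X Y P} → (∀ {Q} → X Q → Y Q) → Closure X P → Closure Y P
  closure-mono f (closure v m) = closure v (λ Γ R c → m Γ R (λ x → c (f x)))

  closure-idem : ∀ {X P} → Closure (Closure X) P → Closure X P
  closure-idem (closure v m) = closure v (λ Γ R c → m Γ R (λ x → Closure.member x Γ R c ≼-refl))

  ⟦⟧-≼ : ∀ α {P Q} → P ≼ Q → ⟦ α ⟧ Q → ⟦ α ⟧ P
  ⟦⟧-≼ (var n) h (v , d)  = valid-≼ h v , λ h′ → d (≼-trans h′ h)
  ⟦⟧-≼ (α · β) h x        = closure-≼ h x
  ⟦⟧-≼ (α \\ β) h (v , d) = valid-≼ h v , λ x → ⟦⟧-≼ β (step keep h) (d x)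
  ⟦⟧-≼ (α ∧ β) h (x , y)  = ⟦⟧-≼ α h x , ⟦⟧-≼ β h y
  ⟦⟧-≼ (α ∨ β) h x        = closure-≼ h x
  ⟦⟧-≼ (¬ α) h (v , d)    = valid-≼ h v , λ h′ → d (≼-trans h′ h)

  -- Membership is itself a family of tests: a variable is a root `pos`, a negation gives roots
  -- `top`, and the antecedent of a residual joins the context.
  ⟦⟧-closed : ∀ α {P} → Closure ⟦ α ⟧ P → ⟦ α ⟧ P
  ⟦⟧-closed (var n) (closure v m) = v , m [] (pos (var n)) (λ (_ , d) → d ≼-refl)
  ⟦⟧-closed (α · β) x = closure-idem x
  ⟦⟧-closed (α \\ β) (closure v m) = v , λ x → ⟦⟧-closed β (closure (factor-valid x)
    λ { Γ R c (step h h′) → m (Γ ▸ _) R (λ (_ , d) → c (d (factor-≼ h x))) h′ })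
  ⟦⟧-closed (α ∧ β) x = ⟦⟧-closed α (closure-mono proj₁ x) , ⟦⟧-closed β (closure-mono proj₂ x)
  ⟦⟧-closed (α ∨ β) x = closure-idem x
  ⟦⟧-closed (¬ α) (closure v m) = v , λ h x → m [] (top _) (λ (_ , d) → d ≼-refl x) h

  -- Okada's lemma and soundness of the model

  mutual
    -- Together with `⟦⟧-bound` it places `⟦ α ⟧` between the formula `α` and all that entails `α`.
    -- The induction is simultaneous because either half for `¬ α` uses the other half for `α`.
    ⟦⟧-self : ∀ α → ⟦ α ⟧ ⌊ α ⌋
    ⟦⟧-self (var n) = tt , λ { base (k , _) _ → ident (small-wt (var n) k) }
    ⟦⟧-self (α · β) = closure tt λ { Γ R c base → ·-left Γ R (c (prod exact (⟦⟧-self β))) }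
    ⟦⟧-self (α \\ β) = tt , λ x → ⟦⟧-closed β (closure (factor-valid x)
      λ { Γ R c (step h base) → evaluate Γ R (factor-≼ h x) (c (⟦⟧-self β)) })
      where
      evaluate : ∀ {X F} Γ R → Factor X α F → ⌊ β ⌋ ⊩ Γ ∣ R → F ▹ ⌊ α \\ β ⌋ ⊩ Γ ∣ R
      evaluate Γ R exact       = \\-left Γ R
      evaluate Γ R (group _ v) = \\-left-grp v Γ R
    ⟦⟧-self (α ∧ β) =
      ⟦⟧-closed α (closure tt λ { Γ R c base → ∧-left₁ Γ R (c (⟦⟧-self α)) }) ,
      ⟦⟧-closed β (closure tt λ { Γ R c base → ∧-left₂ Γ R (c (⟦⟧-self β)) })
    ⟦⟧-self (α ∨ β) = closure tt λ { Γ R c base → ∨-left Γ R (c (inj₁ (⟦⟧-self α))) (c (inj₂ (⟦⟧-self β))) }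
    ⟦⟧-self (¬ α) = tt , λ { base {Q} x →
      ⊥-sym {thaw Q} {⌈ ¬ α ⌉} (¬-left (⟦⟧-valid α x) (λ h → ⟦⟧-bound α (⟦⟧-≼ α h x))) }

    ⟦⟧-bound : ∀ α {P} → ⟦ α ⟧ P → P ⊩ pos α
    ⟦⟧-bound (var n) (_ , d) = d ≼-refl
    ⟦⟧-bound (α · β) (closure _ m) = m [] (pos (α · β)) bound ≼-refl
      where
      bound : ∀ {Q} → Product ⟦ α ⟧ α ⟦ β ⟧ Q → Q ⊩ pos (α · β)
      bound (prod {F} {P} x y) = subst (λ δ → F ▹ P ⊩ pos (δ · β)) (factor-label x) (·-right {F} {P} {β} (⟦⟧-bound β y))
    ⟦⟧-bound (α \\ β) {P} (_ , d) = \\-right {P} (⟦⟧-bound β (d exact))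
    ⟦⟧-bound (α ∧ β) {P} (x , y) = ∧-right {P} (⟦⟧-bound α x) (⟦⟧-bound β y)
    ⟦⟧-bound (α ∨ β) (closure _ m) = m [] (pos (α ∨ β))
      (λ { {Q} (inj₁ x) → ∨-right₁ {Q} (⟦⟧-bound α x) ; {Q} (inj₂ y) → ∨-right₂ {Q} (⟦⟧-bound β y) }) ≼-refl
    ⟦⟧-bound (¬ α) {P} (_ , d) = ¬-right {P} (d ≼-refl (⟦⟧-self α))

  closure-product : ∀ α β {F P} → Factor ⟦ α ⟧ α F → ⟦ β ⟧ P → ⟦ α · β ⟧ (F ▹ P)
  closure-product α β x y = closure (factor-valid x)
    λ { Γ R c (step h h′) → c (prod (factor-≼ h x) (⟦⟧-≼ β h′ y)) }

  -- Lets any member of `⟦ α ⟧` act on the left of a product, as a group labelled `α`; `Neg` needs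
  -- this.
  self-factor : ∀ α {Q} → ⟦ α ⟧ Q → Factor ⟦ α ⟧ α (grp (thaw Q) α)
  self-factor α {Q} x = group (λ {M} p → ⊥-sym {M} {thaw Q} (p x))
    (⊥-sym {⌈ ¬ α ⌉} {thaw Q} (proj₂ (⟦⟧-self (¬ α)) base x))

  factor-perp : ∀ α {F M} → Factor ⟦ α ⟧ α F → Perp ⟦ α ⟧ M → root F ⊥ M
  factor-perp α {M = M} exact p = ⊥-sym {M} {⌈ α ⌉} (p (⟦⟧-self α))
  factor-perp α (group b _) p   = b p

  sound : ∀ {α β} → α ⇒ β → ∀ {P} → ⟦ α ⟧ P → ⟦ β ⟧ P
  sound Id x = x
  sound (RES\\ {α} {β} d) y = ⟦⟧-valid β y , λ x → sound d (closure-product α β x y)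
  sound (RES⁻\\ {α} {β} {γ} d) x = ⟦⟧-closed γ (closure-mono (λ { (prod y z) → proj₂ (sound d z) y }) x)
  sound (∧L₁ d) (x , _) = sound d x
  sound (∧L₂ d) (_ , x) = sound d x
  sound (∧R d e) x = sound d x , sound e x
  sound (∨L {β = β} d e) x = ⟦⟧-closed β (closure-mono (λ { (inj₁ y) → sound d y ; (inj₂ z) → sound e z }) x)
  sound (∨R₁ {α} d) x = closure (⟦⟧-valid α x) (λ Γ R c h → c (inj₁ (sound d (⟦⟧-≼ α h x))))
  sound (∨R₂ {α} d) x = closure (⟦⟧-valid α x) (λ Γ R c h → c (inj₂ (sound d (⟦⟧-≼ α h x))))
  sound (Neg {α} {β} {γ} d) x = ⟦⟧-closed (¬ α) (closure-mono swap x)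
    where
    swap : ∀ {Q} → Product ⟦ γ ⟧ γ ⟦ β ⟧ Q → ⟦ ¬ α ⟧ Q
    -- The hypothesis on `α · β`, applied to the group `thaw Q` in front of `P`, makes `thaw Q ⊙ P`
    -- orthogonal to `⟦ γ ⟧` and so to the factor `G`. Rotation then exchanges `G` and `thaw Q`.
    swap (prod g y) = factor-valid g , λ { (step {G} {P = P} h h′) {Q} z →
      ⊥-rotate {thaw Q} {P} {root G} (⊥-sym {root G} {thaw Q ⊙ P}
        (factor-perp γ {M = thaw Q ⊙ P} (factor-≼ h g)
          (proj₂ (sound d (closure-product α β (self-factor α z) (⟦⟧-≼ β h′ y))) ≼-refl))) }
  sound (MN {α} {γ} d) {P} x = ⟦⟧-valid γ x , λ {P′} h {Q} y →
    ⊥-sym {thaw Q} {thaw P′} (proj₂ (sound d y) ≼-refl (⟦⟧-≼ γ h x))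
  sound (Cut d e) x = sound e (sound d x)

  -- Cuts of the given derivation become composition of inclusions in the model, and the bounded
  -- derivation is read off at the point `⌊ α ⌋`.
  complete : ∀ {α β} → wt α ≤ K → wt β ≤ K → α ⇒ β → α ⊢ β
  complete {α} {β} a b d = ⟦⟧-bound β (sound d (⟦⟧-self α)) (a , ≤-trans (+-mono-≤ b a) (m≤m+n (K + K) K)) b

-- Saturation of a finite set under rules

record Extraction {A : Set} (P : A → Set) (xs : List A) : Set where
  field
    item  : A
    rest  : List A
    holds : P item
    len   : length xs ≡ suc (length rest)
    split : ∀ {y} → y ∈ xs → y ≡ item ⊎ y ∈ rest

extract : ∀ {A : Set} {P : A → Set} {xs} → Any P xs → Extraction P xs
extract {xs = x ∷ xs} (here p) = record
  { item = x ; rest = xs ; holds = p ; len = refl ; split = λ { (here e) → inj₁ e ; (there i) → inj₂ i } }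
extract {xs = x ∷ xs} (there a) = record
  { item = item ; rest = x ∷ rest ; holds = holds ; len = cong suc len ; split = λ { (here e) → inj₂ (here e) ; (there i) → next (split i) } }
  where
  open Extraction (extract a)
  next : ∀ {y} → y ≡ item ⊎ y ∈ rest → y ≡ item ⊎ y ∈ x ∷ rest
  next (inj₁ e) = inj₁ e
  next (inj₂ i) = inj₂ (there i)

module Saturation {A : Set} (_≟_ : DecidableEquality A) (R : A → Set)
                  (rules : ∀ c → List (∃ λ ps → All R ps → R c)) where

  open import Data.List.Membership.DecPropositional _≟_ using (_∈?_)

  Step : List A → A → Set
  Step X c = Any (λ r → All (_∈ X) (proj₁ r)) (rules c)

  step? : ∀ X c → Dec (Step X c)
  step? X c = any? (λ r → all? (_∈? X) (proj₁ r)) (rules c)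

  step-sound : ∀ {X c} → All R X → Step X c → R c
  step-sound {X} {c} r = go (rules c)
    where
    premises : ∀ {ps} → All (_∈ X) ps → All R ps
    premises []       = []
    premises (i ∷ is) = lookup r i ∷ premises is
    go : ∀ rs → Any (λ r → All (_∈ X) (proj₁ r)) rs → R c
    go ((_ , f) ∷ _) (here ps) = f (premises ps)
    go (_ ∷ rs) (there s)      = go rs s

  -- Each round moves one derivable candidate from `rest` to `X`, so the length of `rest` bounds the
  -- number of rounds.
  saturate : (U : List A) → ∃ λ X → All R X × (∀ {c} → c ∈ U → Step X c → c ∈ X)
  saturate U = go (length U) U [] ≤-refl inj₂ []
    where
    go : ∀ n rest X → length rest ≤ n → (∀ {c} → c ∈ U → c ∈ X ⊎ c ∈ rest) →
         All R X → ∃ λ X → All R X × (∀ {c} → c ∈ U → Step X c → c ∈ X)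
    go n rest X len cover r with any? (step? X) rest
    ... | no none = X , r , stable
      where
      stable : ∀ {c} → c ∈ U → Step X c → c ∈ X
      stable i s with cover i
      ... | inj₁ j = j
      ... | inj₂ j = contradiction (lose j s) none
    go zero (_ ∷ _) X () cover r | yes _
    go (suc n) rest X len cover r | yes a =
      go n E.rest (E.item ∷ X) (≤-pred (subst (_≤ suc n) E.len len)) (λ i → next (cover i)) (step-sound r E.holds ∷ r)
      where
      module E = Extraction (extract a)
      next : ∀ {c} → c ∈ X ⊎ c ∈ rest → c ∈ E.item ∷ X ⊎ c ∈ E.rest
      next (inj₁ i) = inj₁ (there i)
      next (inj₂ i) with E.split i
      ... | inj₁ e = inj₁ (here e)
      ... | inj₂ j = inj₂ j

-- Enumeration of the formulas of bounded size

_≟_ : DecidableEquality Formula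
var m ≟ var n = map′ (cong var) (λ { refl → refl }) (m ℕ.≟ n)
(α · β) ≟ (γ · δ) = map′ (λ (p , q) → cong₂ _·_ p q) (λ { refl → refl , refl }) (α ≟ γ ×-dec β ≟ δ)
(α \\ β) ≟ (γ \\ δ) = map′ (λ (p , q) → cong₂ _\\_ p q) (λ { refl → refl , refl }) (α ≟ γ ×-dec β ≟ δ)
(α ∧ β) ≟ (γ ∧ δ) = map′ (λ (p , q) → cong₂ _∧_ p q) (λ { refl → refl , refl }) (α ≟ γ ×-dec β ≟ δ)
(α ∨ β) ≟ (γ ∨ δ) = map′ (λ (p , q) → cong₂ _∨_ p q) (λ { refl → refl , refl }) (α ≟ γ ×-dec β ≟ δ)
(¬ α) ≟ (¬ β) = map′ (cong ¬_) (λ { refl → refl }) (α ≟ β)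
(_ · _) ≟ (_ \\ _) = no λ ()
(_ · _) ≟ (_ ∧ _) = no λ ()
(_ · _) ≟ (_ ∨ _) = no λ ()
(_ · _) ≟ (¬ _) = no λ ()
(_ · _) ≟ (var _) = no λ ()
(_ \\ _) ≟ (_ · _) = no λ ()
(_ \\ _) ≟ (_ ∧ _) = no λ ()
(_ \\ _) ≟ (_ ∨ _) = no λ ()
(_ \\ _) ≟ (¬ _) = no λ ()
(_ \\ _) ≟ (var _) = no λ ()
(_ ∧ _) ≟ (_ · _) = no λ ()
(_ ∧ _) ≟ (_ \\ _) = no λ ()
(_ ∧ _) ≟ (_ ∨ _) = no λ ()
(_ ∧ _) ≟ (¬ _) = no λ ()
(_ ∧ _) ≟ (var _) = no λ ()
(_ ∨ _) ≟ (_ · _) = no λ ()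
(_ ∨ _) ≟ (_ \\ _) = no λ ()
(_ ∨ _) ≟ (_ ∧ _) = no λ ()
(_ ∨ _) ≟ (¬ _) = no λ ()
(_ ∨ _) ≟ (var _) = no λ ()
(¬ _) ≟ (_ · _) = no λ ()
(¬ _) ≟ (_ \\ _) = no λ ()
(¬ _) ≟ (_ ∧ _) = no λ ()
(¬ _) ≟ (_ ∨ _) = no λ ()
(¬ _) ≟ (var _) = no λ ()
(var _) ≟ (_ · _) = no λ ()
(var _) ≟ (_ \\ _) = no λ ()
(var _) ≟ (_ ∧ _) = no λ ()
(var _) ≟ (_ ∨ _) = no λ ()
(var _) ≟ (¬ _) = no λ ()

binary : List Formula → List Formula
binary T = with-op _·_ ++ with-op _\\_ ++ with-op _∧_ ++ with-op _∨_
  where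
  with-op : (Formula → Formula → Formula) → List Formula
  with-op f = cartesianProductWith f T T

-- Bounded size leaves finitely many variables, because `size (var n)` grows with the index.
formulas : ℕ → List Formula
formulas zero    = []
formulas (suc n) = map var (upTo (suc n)) ++ map ¬_ T ++ binary T
  where T = formulas n

∈-formulas : ∀ {n} α → size α ≤ n → α ∈ formulas n
∈-formulas (var m) (s≤s h) = ∈-++⁺ˡ (∈-map⁺ var (∈-upTo⁺ (s≤s h)))
∈-formulas {suc n} (¬ α) (s≤s h) = ∈-++⁺ʳ (map var (upTo (suc n))) (∈-++⁺ˡ (∈-map⁺ ¬_ (∈-formulas α h)))
∈-formulas {suc n} (α · β) (s≤s h) = ∈-++⁺ʳ (map var (upTo (suc n))) (∈-++⁺ʳ (map ¬_ T) (∈-++⁺ˡ αβ))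
  where
  T = formulas n
  αβ = ∈-cartesianProductWith⁺ _·_ (∈-formulas α (m+n≤o⇒m≤o (size α) h)) (∈-formulas β (m+n≤o⇒n≤o (size α) h))
∈-formulas {suc n} (α \\ β) (s≤s h) = ∈-++⁺ʳ (map var (upTo (suc n))) (∈-++⁺ʳ (map ¬_ T) (∈-++⁺ʳ (cartesianProductWith _·_ T T) (∈-++⁺ˡ αβ)))
  where
  T = formulas n
  αβ = ∈-cartesianProductWith⁺ _\\_ (∈-formulas α (m+n≤o⇒m≤o (size α) h)) (∈-formulas β (m+n≤o⇒n≤o (size α) h))
∈-formulas {suc n} (α ∧ β) (s≤s h) = ∈-++⁺ʳ (map var (upTo (suc n))) (∈-++⁺ʳ (map ¬_ T) (∈-++⁺ʳ (cartesianProductWith _·_ T T) (∈-++⁺ʳ (cartesianProductWith _\\_ T T) (∈-++⁺ˡ αβ))))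
  where
  T = formulas n
  αβ = ∈-cartesianProductWith⁺ _∧_ (∈-formulas α (m+n≤o⇒m≤o (size α) h)) (∈-formulas β (m+n≤o⇒n≤o (size α) h))
∈-formulas {suc n} (α ∨ β) (s≤s h) = ∈-++⁺ʳ (map var (upTo (suc n))) (∈-++⁺ʳ (map ¬_ T) (∈-++⁺ʳ (cartesianProductWith _·_ T T) (∈-++⁺ʳ (cartesianProductWith _\\_ T T) (∈-++⁺ʳ (cartesianProductWith _∧_ T T) αβ))))
  where
  T = formulas n
  αβ = ∈-cartesianProductWith⁺ _∨_ (∈-formulas α (m+n≤o⇒m≤o (size α) h)) (∈-formulas β (m+n≤o⇒n≤o (size α) h))

-- The rules as finite lists of inferences

Sequent : Set
Sequent = Formula × Formula

Derivable : Sequent → Set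
Derivable (α , β) = α ⇒ β

Inference : Sequent → Set
Inference c = ∃ λ ps → All Derivable ps → Derivable c

left-rules : ∀ α β → List (Inference (α , β))
left-rules (α · β) γ = ((β , α \\ γ) ∷ [] , λ { (d ∷ []) → RES⁻\\ d }) ∷ []
left-rules (α ∧ β) γ = ((α , γ) ∷ [] , λ { (d ∷ []) → ∧L₁ d }) ∷ ((β , γ) ∷ [] , λ { (d ∷ []) → ∧L₂ d }) ∷ []
left-rules (α ∨ β) γ = ((α , γ) ∷ (β , γ) ∷ [] , λ { (d ∷ e ∷ []) → ∨L d e }) ∷ []
left-rules _ _       = []

right-rules : ∀ α β → List (Inference (α , β))
right-rules α (β \\ γ) = ((β · α , γ) ∷ [] , λ { (d ∷ []) → RES\\ d }) ∷ []
right-rules α (β ∧ γ)  = ((α , β) ∷ (α , γ) ∷ [] , λ { (d ∷ e ∷ []) → ∧R d e }) ∷ []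
right-rules α (β ∨ γ)  = ((α , β) ∷ [] , λ { (d ∷ []) → ∨R₁ d }) ∷ ((α , γ) ∷ [] , λ { (d ∷ []) → ∨R₂ d }) ∷ []
right-rules α (¬ β)    = ((β , ¬ α) ∷ [] , λ { (d ∷ []) → MN d }) ∷ []
right-rules _ _        = []

neg-rules : ∀ α β → List (Inference (α , β))
neg-rules (γ · β) (¬ α) = ((α · β , ¬ γ) ∷ [] , λ { (d ∷ []) → Neg d }) ∷ []
neg-rules _ _           = []

id-rule : ∀ α β → List (Inference (α , β))
id-rule α β with α ≟ β
... | yes refl = ([] , λ _ → Id) ∷ []
... | no _     = []

cut-rule : ∀ α β → Formula → Inference (α , β)
cut-rule α γ β = (α , β) ∷ (β , γ) ∷ [] , λ { (d ∷ e ∷ []) → Cut d e }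

rules : List Formula → ∀ c → List (Inference c)
rules T (α , β) = map (cut-rule α β) T ++ id-rule α β ++ left-rules α β ++ right-rules α β ++ neg-rules α β

-- Derivability with bounded formulas and the decision

module _ (B : ℕ) where

  private T = formulas B

  open Saturation (≡-dec _≟_ _≟_) Derivable (rules T)

  saturated : ∃ λ X → All Derivable X × (∀ {c} → c ∈ cartesianProduct T T → Step X c → c ∈ X)
  saturated = saturate (cartesianProduct T T)

  X : List Sequent
  X = proj₁ saturated

  _⊢_ : Formula → Formula → Set
  α ⊢ β = (α , β) ∈ X × size α ≤ B × size β ≤ B

  ⊢-sound : ∀ {α β} → (α , β) ∈ X → α ⇒ β
  ⊢-sound = lookup (proj₁ (proj₂ saturated))

  infer : ∀ {α β} → size α ≤ B → size β ≤ B → Step X (α , β) → α ⊢ β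
  infer {α} {β} a b s =
    proj₂ (proj₂ saturated) (∈-cartesianProduct⁺ (∈-formulas α a) (∈-formulas β b)) s , a , b

  module _ {α β : Formula} where
    Fires : List (Inference (α , β)) → Set
    Fires = Any (λ r → All (_∈ X) (proj₁ r))

    by-cut : Fires (map (cut-rule α β) T) → Step X (α , β)
    by-cut = ++⁺ˡ

    by-id : Fires (id-rule α β) → Step X (α , β)
    by-id s = ++⁺ʳ (map (cut-rule α β) T) (++⁺ˡ s)

    by-left : Fires (left-rules α β) → Step X (α , β)
    by-left s = ++⁺ʳ (map (cut-rule α β) T) (++⁺ʳ (id-rule α β) (++⁺ˡ s))

    by-right : Fires (right-rules α β) → Step X (α , β)
    by-right s = ++⁺ʳ (map (cut-rule α β) T) (++⁺ʳ (id-rule α β) (++⁺ʳ (left-rules α β) (++⁺ˡ s)))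

    by-neg : Fires (neg-rules α β) → Step X (α , β)
    by-neg s = ++⁺ʳ (map (cut-rule α β) T) (++⁺ʳ (id-rule α β) (++⁺ʳ (left-rules α β) (++⁺ʳ (right-rules α β) s)))

  id-fires : ∀ α → Fires (id-rule α α)
  id-fires α with α ≟ α
  ... | yes refl = here []
  ... | no α≢α   = contradiction refl α≢α

  ⊢-closed : Closed B _⊢_
  ⊢-closed = record
    { ident  = λ {α} s → infer s s (by-id (id-fires α))
    ; res    = λ {α} s (i , a , _) → infer (m+n≤o⇒n≤o (suc (size α)) a) s (by-right (here (i ∷ [])))
    ; unres  = λ {α} s (i , _ , b) → infer s (m+n≤o⇒n≤o (suc (size α)) b) (by-left (here (i ∷ [])))
    ; ∧l₁    = λ s (i , _ , b) → infer s b (by-left (here (i ∷ [])))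
    ; ∧l₂    = λ s (i , _ , b) → infer s b (by-left (there (here (i ∷ []))))
    ; ∧r     = λ s (i , a , _) (j , _) → infer a s (by-right (here (i ∷ j ∷ [])))
    ; ∨l     = λ s (i , _ , b) (j , _) → infer s b (by-left (here (i ∷ j ∷ [])))
    ; ∨r₁    = λ s (i , a , _) → infer a s (by-right (here (i ∷ [])))
    ; ∨r₂    = λ s (i , a , _) → infer a s (by-right (there (here (i ∷ []))))
    ; neg·   = λ s t (i , _) → infer s t (by-neg (here (i ∷ [])))
    ; neg    = λ s (i , _ , b) → infer (<⇒≤ b) s (by-right (here (i ∷ [])))
    ; cut    = λ {_} {β} (i , a , b) (j , _ , c) → infer a c
                 (by-cut (map⁺ (lose (∈-formulas β b) (i ∷ j ∷ []))))
    }

theorem8 : (α β : Formula) → Dec (α ⇒ β)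
theorem8 α β = map′ (⊢-sound B) (proj₁ ∘ complete (m≤m⊔n (wt α) (wt β)) (m≤n⊔m (wt α) (wt β)))
  ((α , β) ∈? X B)
  where
  K = wt α ⊔ wt β
  -- Leaves weigh at most `K` and admissible sequents at most `3K`; doubling passes from weight to
  -- size as in `sizeᵖ`.
  B = (K + K + K) + (K + K + K)
  open Model K (_⊢_ B) (⊢-closed B) using (complete)
  open import Data.List.Membership.DecPropositional (≡-dec _≟_ _≟_) using (_∈?_)
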